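{- There exists a $4\times 4$ limited augmented bipartite graph $G=(S,T,E_1\cup E_2)$ satisfying (S), (W1), (W2) and (W2'), but violating (W3), whose associated doubly simple biquadratic form satisfies $$\mathrm{SOS}(P_G)\le 10<11=|E_1|+|E_2|.$$ Hence this example is reducible (not irreducible). In particular, (W3) cannot be removed entirely from the weak framework: it is not true that every augmented bipartite graph satisfying (S), (W1), (W2) and (W2') has an irreducible associated form.
   Context: Notation: $[m]=\{1,\dots,m\}$. For an $m\times n$ biquadratic form $P(\mathbf{x},\mathbf{y})$ that is a finite sum of squares of real bilinear forms in $(\mathbf{x},\mathbf{y})$, $\mathrm{SOS}(P)$ (the SOS rank, also written $\operatorname{sos}(P)$) is the minimum number of squares in such a representation. $z(m,n)$ (the Zarankiewicz number) is the maximum number of edges of an $m\times n$ bipartite graph with no $C_4$. Augmented bipartite graphs $G=(S,T,E_1\cup E_2)$, $S=[m]$, $T=[n]$. A cell is a pair $(i,j)\in[m]\times[n]$ ($i$ is its row, $j$ its column). A 1-edge is a cell; $E_1$ is a set of 1-edges, viewed as a bipartite graph $G_1$ on $S,T$. A 2-edge is an unordered pair of distinct cells, written $(i,j;k,l)$; the cells $(i,j)$ and $(k,l)$ are its two halves. It is nondegenerate if $i\ne k$ and $j\ne l$, row-degenerate if $i=k$ and $j\neq l$, column-degenerate if $i\ne k$ and $j=l$. $E_2$ is a set of 2-edges. $G$ is called limited if $|E_1|=z(m,n)$. The associated doubly simple biquadratic form is $P_G=\sum_{(i,j)\in E_1}x_i^2y_j^2+\sum_{(i,j;k,l)\in E_2}(x_iy_j+x_ky_l)^2$;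 it is called irreducible if $\mathrm{SOS}(P_G)=|E_1|+|E_2|$. A cell is occupied if it is in $E_1$ or is a half of some 2-edge in $E_2$; otherwise it is unoccupied. The opposite cells of a nondegenerate 2-edge $(i,j;k,l)$ are $(i,l)$ and $(k,j)$. Two nondegenerate 2-edges of the form $(i,j;k,l)$ and $(i,l;k,j)$ are called complementary. The dependency graph $\mathcal{D}$ is the directed graph whose vertices are the nondegenerate 2-edges in $E_2$, with an arc $e\to e'$ ($e\ne e'$) if both opposite cells of $e$ are occupied and one half of $e'$ is an opposite cell of $e$. An edge's row (column) set is the set of rows (columns) of its cell (1-edge) or of its halves (2-edge). Two edges are vertex-disjoint if their row sets are disjoint and their column sets are disjoint. The opposite cells of a vertex-disjoint pair $e,f$ are the cells formed by a row of one of the two edges and a column of the other. For a 1-edge $(i,j)$ and a 2-edge $(k,l;p,q)$ they are $(i,l),(i,q),(k,j),(p,j)$. Conditions: (S) No 2-edge shares a cell with any 1-edge or with any other 2-edge. (W1) $G_1$ contains no $C_4$. (W2) $\mathcal{D}$ contains no directed cycle other than 2-cycles formed by a pair of complementary 2-edges (which are allowed). (W2') There is no nondegenerate 2-edge in $E_2$ whose two opposite cells are both 1-edges. (W3) For every vertex-disjoint pair of edges of $G$ at least one of which is a 2-edge, at least one of the opposite cells of the pair is unoccupied. -}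

module Defs where

open import Algebra.Bundles using (CommutativeRing)
import Algebra.Definitions.RawMonoid as RawMonoidDefinitions
open import Data.Fin.Base using (Fin)
open import Data.List.Base
  using (List; []; _∷_; [_]; _++_; _∷ʳ_; length; map; foldr; cartesianProduct)
open import Data.List.Membership.Propositional using (_∈_; _∉_)
open import Data.List.Relation.Binary.Disjoint.Propositional using (Disjoint)
open import Data.List.Relation.Unary.All using (All)
open import Data.List.Relation.Unary.AllPairs using (AllPairs)
open import Data.List.Relation.Unary.Any using (Any)
open import Data.List.Relation.Unary.Linked using (Linked)
open import Data.List.Relation.Unary.Unique.Propositional using (Unique)
open import Data.Nat.Base as ℕ using (ℕ)
import Data.Nat.Properties as ℕ
open import Data.Product.Base
  using (Σ-syntax; ∃-syntax; _×_; _,_; proj₁; proj₂; swap)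
open import Data.Rational.Base as ℚ using (ℚ; 0ℚ; 1ℚ; ½; ∣_∣)
import Data.Rational.Properties as ℚ
open import Data.Rational.Solver using (module +-*-Solver)
open import Data.Sum.Base using (_⊎_)
open import Data.Vec.Functional using (Vector)
open import Level using (0ℓ)
open import Relation.Binary.PropositionalEquality
  using (_≡_; _≢_; refl; sym; trans; cong; subst)
open import Relation.Nullary using (¬_)

------------------------------------------------------------------------
-- The field of real numbers: Cauchy sequences of rationals, compared
-- modulo null sequences

IsNull : (ℕ → ℚ) → Set
IsNull s = ∀ ε → 0ℚ ℚ.< ε → ∃[ N ] (∀ n → N ℕ.≤ n → ∣ s n ∣ ℚ.< ε)

IsCauchy : (ℕ → ℚ) → Set
IsCauchy s =
  ∀ ε → 0ℚ ℚ.< ε →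
  ∃[ N ] (∀ m n → N ℕ.≤ m → N ℕ.≤ n → ∣ s m ℚ.- s n ∣ ℚ.< ε)

record ℝ : Set where
  no-eta-equality
  constructor mkℝ
  field
    seq    : ℕ → ℚ
    cauchy : IsCauchy seq

open ℝ public

infix 4 _≈ℝ_

-- A record, so that the two real numbers can be inferred from a proof.
record _≈ℝ_ (a b : ℝ) : Set where
  no-eta-equality
  constructor mk≈
  field
    null : IsNull (λ n → seq a n ℚ.- seq b n)

open _≈ℝ_ public

module CauchyLemmas where
  half : ∀ {ε} → 0ℚ ℚ.< ε → 0ℚ ℚ.< ½ ℚ.* ε
  half {ε} 0<ε = subst (ℚ._< ½ ℚ.* ε) (ℚ.*-zeroʳ ½) (ℚ.*-monoʳ-<-pos ½ 0<ε)

  half+half : ∀ ε → ½ ℚ.* ε ℚ.+ ½ ℚ.* ε ≡ ε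
  half+half ε =
    trans (sym (ℚ.*-distribʳ-+ ε ½ ½)) (ℚ.*-identityˡ ε)

  ∣+∣< : ∀ {p q ε} → ∣ p ∣ ℚ.< ½ ℚ.* ε → ∣ q ∣ ℚ.< ½ ℚ.* ε →
         ∣ p ℚ.+ q ∣ ℚ.< ε
  ∣+∣< {p} {q} {ε} p< q< =
    ℚ.≤-<-trans (ℚ.∣p+q∣≤∣p∣+∣q∣ p q)
      (subst (_ ℚ.<_) (half+half ε) (ℚ.+-mono-< p< q<))

  ∣*∣< : ∀ {p q B δ} → 0ℚ ℚ.< B → ∣ p ∣ ℚ.≤ B → ∣ q ∣ ℚ.< δ →
         ∣ p ℚ.* q ∣ ℚ.< B ℚ.* δ
  ∣*∣< {p} {q} {B} 0<B p≤ q< =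
    subst (ℚ._< _) (sym (ℚ.∣p*q∣≡∣p∣*∣q∣ p q))
      (ℚ.≤-<-trans
        (ℚ.*-monoʳ-≤-nonNeg ∣ q ∣ {{ℚ.∣-∣-nonNeg q}} p≤)
        (ℚ.*-monoʳ-<-pos B {{ℚ.positive 0<B}} q<))

  rescale : ∀ B → 0ℚ ℚ.< B → ∀ ε → 0ℚ ℚ.< ε →
            ∃[ δ ] (0ℚ ℚ.< δ × B ℚ.* δ ≡ ε)
  rescale B 0<B ε 0<ε = B⁻¹ ℚ.* ε , pos , eq
    where
    instance
      B-pos : ℚ.Positive B
      B-pos = ℚ.positive 0<B
      B-nonZero : ℚ.NonZero B
      B-nonZero = ℚ.pos⇒nonZero B
    B⁻¹ : ℚ
    B⁻¹ = ℚ.1/ B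
    pos : 0ℚ ℚ.< B⁻¹ ℚ.* ε
    pos = subst (ℚ._< B⁻¹ ℚ.* ε) (ℚ.*-zeroʳ B⁻¹)
            (ℚ.*-monoʳ-<-pos B⁻¹ {{ℚ.1/pos⇒pos B}} 0<ε)
    eq : B ℚ.* (B⁻¹ ℚ.* ε) ≡ ε
    eq = trans (sym (ℚ.*-assoc B B⁻¹ ε))
           (trans (cong (ℚ._* ε) (ℚ.*-inverseʳ B)) (ℚ.*-identityˡ ε))

  ⊔ˡ : ∀ {M N n} → M ℕ.⊔ N ℕ.≤ n → M ℕ.≤ n
  ⊔ˡ {M} {N} = ℕ.≤-trans (ℕ.m≤m⊔n M N)

  ⊔ʳ : ∀ {M N n} → M ℕ.⊔ N ℕ.≤ n → N ℕ.≤ n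
  ⊔ʳ {M} {N} = ℕ.≤-trans (ℕ.m≤n⊔m M N)

  EventuallyBounded : (ℕ → ℚ) → Set
  EventuallyBounded s =
    ∃[ B ] (0ℚ ℚ.< B × ∃[ N ] (∀ n → N ℕ.≤ n → ∣ s n ∣ ℚ.≤ B))

  cauchy⇒bounded : ∀ {s} → IsCauchy s → EventuallyBounded s
  cauchy⇒bounded {s} c with c 1ℚ (ℚ.positive⁻¹ 1ℚ)
  ... | N , close = 1ℚ ℚ.+ ∣ s N ∣ , 0<B , N , bound
    where
    0<B : 0ℚ ℚ.< 1ℚ ℚ.+ ∣ s N ∣
    0<B = ℚ.<-≤-trans (ℚ.positive⁻¹ 1ℚ)
            (subst (ℚ._≤ 1ℚ ℚ.+ ∣ s N ∣) (ℚ.+-identityʳ 1ℚ)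
              (ℚ.+-monoʳ-≤ 1ℚ (ℚ.0≤∣p∣ (s N))))
    split : ∀ x y → x ≡ (x ℚ.- y) ℚ.+ y
    split = solve 2 (λ x y → x := (x :- y) :+ y) refl
      where open +-*-Solver
    bound : ∀ n → N ℕ.≤ n → ∣ s n ∣ ℚ.≤ 1ℚ ℚ.+ ∣ s N ∣
    bound n N≤n =
      subst (ℚ._≤ _) (cong ∣_∣ (sym (split (s n) (s N))))
        (ℚ.≤-trans (ℚ.∣p+q∣≤∣p∣+∣q∣ (s n ℚ.- s N) (s N))
          (ℚ.+-monoˡ-≤ ∣ s N ∣ (ℚ.<⇒≤ (close n N N≤n ℕ.≤-refl))))

  constant : ∀ q → IsCauchy (λ _ → q)
  constant q ε 0<ε =
    0 , λ _ _ _ _ → subst (ℚ._< ε) (cong ∣_∣ (sym (ℚ.+-inverseʳ q))) 0<ε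

  +-cauchy : ∀ {s t} → IsCauchy s → IsCauchy t → IsCauchy (λ n → s n ℚ.+ t n)
  +-cauchy {s} {t} cs ct ε 0<ε
    with cs (½ ℚ.* ε) (half 0<ε) | ct (½ ℚ.* ε) (half 0<ε)
  ... | M , close₁ | N , close₂ = M ℕ.⊔ N , λ m n M⊔N≤m M⊔N≤n →
    subst (λ p → ∣ p ∣ ℚ.< ε) (rearrange (s m) (s n) (t m) (t n))
      (∣+∣< {s m ℚ.- s n} {t m ℚ.- t n} {ε}
        (close₁ m n (⊔ˡ {M} {N} M⊔N≤m) (⊔ˡ {M} {N} M⊔N≤n))
        (close₂ m n (⊔ʳ {M} {N} M⊔N≤m) (⊔ʳ {M} {N} M⊔N≤n)))
    where
    open +-*-Solver
    rearrange : ∀ a b c d →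
      (a ℚ.- b) ℚ.+ (c ℚ.- d) ≡ (a ℚ.+ c) ℚ.- (b ℚ.+ d)
    rearrange =
      solve 4 (λ a b c d → (a :- b) :+ (c :- d) := (a :+ c) :- (b :+ d)) refl

  -‿cauchy : ∀ {s} → IsCauchy s → IsCauchy (λ n → ℚ.- s n)
  -‿cauchy {s} cs ε 0<ε with cs ε 0<ε
  ... | N , close = N , λ m n N≤m N≤n →
    subst (ℚ._< ε)
      (trans (sym (ℚ.∣-p∣≡∣p∣ (s m ℚ.- s n))) (cong ∣_∣ (rearrange (s m) (s n))))
      (close m n N≤m N≤n)
    where
    open +-*-Solver
    rearrange : ∀ a b → ℚ.- (a ℚ.- b) ≡ (ℚ.- a) ℚ.- (ℚ.- b)
    rearrange = solve 2 (λ a b → :- (a :- b) := (:- a) :- (:- b)) refl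

  product-close : ∀ a b c d {B C δ γ ε} → 0ℚ ℚ.< B → 0ℚ ℚ.< C →
    B ℚ.* δ ≡ ½ ℚ.* ε → C ℚ.* γ ≡ ½ ℚ.* ε →
    ∣ a ∣ ℚ.≤ B → ∣ d ∣ ℚ.≤ C → ∣ c ℚ.- d ∣ ℚ.< δ → ∣ a ℚ.- b ∣ ℚ.< γ →
    ∣ a ℚ.* c ℚ.- b ℚ.* d ∣ ℚ.< ε
  product-close a b c d {B} {C} {δ} {γ} {ε} 0<B 0<C Bδ≡ Cγ≡ a≤B d≤C c-d a-b =
    subst (λ p → ∣ p ∣ ℚ.< ε) (rearrange a b c d)
      (∣+∣< {a ℚ.* (c ℚ.- d)} {d ℚ.* (a ℚ.- b)} {ε}
        (subst (∣ a ℚ.* (c ℚ.- d) ∣ ℚ.<_) Bδ≡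
          (∣*∣< {a} {c ℚ.- d} {B} {δ} 0<B a≤B c-d))
        (subst (∣ d ℚ.* (a ℚ.- b) ∣ ℚ.<_) Cγ≡
          (∣*∣< {d} {a ℚ.- b} {C} {γ} 0<C d≤C a-b)))
    where
    open +-*-Solver
    rearrange : ∀ a b c d →
      a ℚ.* (c ℚ.- d) ℚ.+ d ℚ.* (a ℚ.- b) ≡ a ℚ.* c ℚ.- b ℚ.* d
    rearrange =
      solve 4 (λ a b c d → a :* (c :- d) :+ d :* (a :- b) := a :* c :- b :* d) refl

  *-cauchy : ∀ {s t} → IsCauchy s → IsCauchy t → IsCauchy (λ n → s n ℚ.* t n)
  *-cauchy {s} {t} cs ct ε 0<ε =
    let B , 0<B , K , s≤B = cauchy⇒bounded {s} cs
        C , 0<C , L , t≤C = cauchy⇒bounded {t} ct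
        δ , 0<δ , Bδ≡     = rescale B 0<B (½ ℚ.* ε) (half 0<ε)
        γ , 0<γ , Cγ≡     = rescale C 0<C (½ ℚ.* ε) (half 0<ε)
        M , close₁        = ct δ 0<δ
        N , close₂        = cs γ 0<γ
    in (K ℕ.⊔ L) ℕ.⊔ (M ℕ.⊔ N) , λ m n ≤m ≤n →
      product-close (s m) (s n) (t m) (t n) {B} {C} {δ} {γ} {ε} 0<B 0<C Bδ≡ Cγ≡
        (s≤B m (⊔ˡ {K} {L} (⊔ˡ {K ℕ.⊔ L} {M ℕ.⊔ N} ≤m)))
        (t≤C n (⊔ʳ {K} {L} (⊔ˡ {K ℕ.⊔ L} {M ℕ.⊔ N} ≤n)))
        (close₁ m n (⊔ˡ {M} {N} (⊔ʳ {K ℕ.⊔ L} {M ℕ.⊔ N} ≤m))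
                    (⊔ˡ {M} {N} (⊔ʳ {K ℕ.⊔ L} {M ℕ.⊔ N} ≤n)))
        (close₂ m n (⊔ʳ {M} {N} (⊔ʳ {K ℕ.⊔ L} {M ℕ.⊔ N} ≤m))
                    (⊔ʳ {M} {N} (⊔ʳ {K ℕ.⊔ L} {M ℕ.⊔ N} ≤n)))

open CauchyLemmas

-- The operations are defined by copatterns so that they unfold only
-- under a projection.

fromℚ : ℚ → ℝ
fromℚ q .seq _  = q
fromℚ q .cauchy = constant q

infixl 6 _+ℝ_
infixl 7 _*ℝ_
infix  8 -ℝ_

_+ℝ_ : ℝ → ℝ → ℝ
(a +ℝ b) .seq n  = seq a n ℚ.+ seq b n
(a +ℝ b) .cauchy = +-cauchy {seq a} {seq b} (cauchy a) (cauchy b)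

_*ℝ_ : ℝ → ℝ → ℝ
(a *ℝ b) .seq n  = seq a n ℚ.* seq b n
(a *ℝ b) .cauchy = *-cauchy {seq a} {seq b} (cauchy a) (cauchy b)

-ℝ_ : ℝ → ℝ
(-ℝ a) .seq n  = ℚ.- seq a n
(-ℝ a) .cauchy = -‿cauchy {seq a} (cauchy a)

module ≈ℝ-Lemmas where
  pointwise : ∀ {a b} → (∀ n → seq a n ≡ seq b n) → a ≈ℝ b
  pointwise {a} {b} eq .null ε 0<ε = 0 , λ n _ →
    subst (ℚ._< ε)
      (cong ∣_∣ (sym (trans (cong (ℚ._- seq b n) (eq n)) (ℚ.+-inverseʳ (seq b n)))))
      0<ε

  null-+ : ∀ s t → IsNull s → IsNull t → IsNull (λ n → s n ℚ.+ t n)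
  null-+ s t zs zt ε 0<ε
    with zs (½ ℚ.* ε) (half 0<ε) | zt (½ ℚ.* ε) (half 0<ε)
  ... | M , small₁ | N , small₂ = M ℕ.⊔ N , λ n M⊔N≤n →
    ∣+∣< {s n} {t n} {ε}
      (small₁ n (⊔ˡ {M} {N} M⊔N≤n)) (small₂ n (⊔ʳ {M} {N} M⊔N≤n))

  null-* : ∀ s t → EventuallyBounded s → IsNull t → IsNull (λ n → s n ℚ.* t n)
  null-* s t (B , 0<B , M , s≤B) zt ε 0<ε with rescale B 0<B ε 0<ε
  ... | δ , 0<δ , Bδ≡ with zt δ 0<δ
  ... | N , small = M ℕ.⊔ N , λ n M⊔N≤n →
    subst (_ ℚ.<_) Bδ≡
      (∣*∣< {s n} {t n} {B} {δ} 0<B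
        (s≤B n (⊔ˡ {M} {N} M⊔N≤n)) (small n (⊔ʳ {M} {N} M⊔N≤n)))

  null-neg : ∀ s → IsNull s → IsNull (λ n → ℚ.- s n)
  null-neg s zs ε 0<ε with zs ε 0<ε
  ... | N , small = N , λ n N≤n →
    subst (ℚ._< ε) (sym (ℚ.∣-p∣≡∣p∣ (s n))) (small n N≤n)

  null-ext : ∀ {s t : ℕ → ℚ} → (∀ n → s n ≡ t n) → IsNull s → IsNull t
  null-ext eq zs ε 0<ε with zs ε 0<ε
  ... | N , small = N , λ n N≤n →
    subst (ℚ._< ε) (cong ∣_∣ (eq n)) (small n N≤n)

  open +-*-Solver

  ≈-sym : ∀ {a b} → a ≈ℝ b → b ≈ℝ a
  ≈-sym {a} {b} a≈b .null =
    null-ext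
      (λ n → solve 2 (λ x y → :- (x :- y) := y :- x) refl (seq a n) (seq b n))
      (null-neg (λ n → seq a n ℚ.- seq b n) (null a≈b))

  ≈-trans : ∀ {a b c} → a ≈ℝ b → b ≈ℝ c → a ≈ℝ c
  ≈-trans {a} {b} {c} a≈b b≈c .null =
    null-ext
      (λ n → solve 3 (λ x y z → (x :- y) :+ (y :- z) := x :- z) refl
               (seq a n) (seq b n) (seq c n))
      (null-+ (λ n → seq a n ℚ.- seq b n) (λ n → seq b n ℚ.- seq c n)
        (null a≈b) (null b≈c))

  +-cong : ∀ {a b c d} → a ≈ℝ b → c ≈ℝ d → a +ℝ c ≈ℝ b +ℝ d
  +-cong {a} {b} {c} {d} a≈b c≈d .null =
    null-ext
      (λ n → solve 4 (λ x y z w → (x :- y) :+ (z :- w) := (x :+ z) :- (y :+ w))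
               refl (seq a n) (seq b n) (seq c n) (seq d n))
      (null-+ (λ n → seq a n ℚ.- seq b n) (λ n → seq c n ℚ.- seq d n)
        (null a≈b) (null c≈d))

  *-cong : ∀ {a b c d} → a ≈ℝ b → c ≈ℝ d → a *ℝ c ≈ℝ b *ℝ d
  *-cong {a} {b} {c} {d} a≈b c≈d .null =
    null-ext
      (λ n → solve 4 (λ x y z w → x :* (z :- w) :+ w :* (x :- y) := x :* z :- y :* w)
               refl (seq a n) (seq b n) (seq c n) (seq d n))
      (null-+
        (λ n → seq a n ℚ.* (seq c n ℚ.- seq d n))
        (λ n → seq d n ℚ.* (seq a n ℚ.- seq b n))
        (null-* (seq a) (λ n → seq c n ℚ.- seq d n)
          (cauchy⇒bounded {seq a} (cauchy a)) (null c≈d))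
        (null-* (seq d) (λ n → seq a n ℚ.- seq b n)
          (cauchy⇒bounded {seq d} (cauchy d)) (null a≈b)))

  -‿cong : ∀ {a b} → a ≈ℝ b → -ℝ a ≈ℝ -ℝ b
  -‿cong {a} {b} a≈b .null =
    null-ext
      (λ n → solve 2 (λ x y → :- (x :- y) := (:- x) :- (:- y)) refl
               (seq a n) (seq b n))
      (null-neg (λ n → seq a n ℚ.- seq b n) (null a≈b))

open ≈ℝ-Lemmas

ℝ-commutativeRing : CommutativeRing 0ℓ 0ℓ
ℝ-commutativeRing = record
  { Carrier = ℝ
  ; _≈_     = _≈ℝ_
  ; _+_     = _+ℝ_
  ; _*_     = _*ℝ_
  ; -_      = -ℝ_
  ; 0#      = fromℚ 0ℚ
  ; 1#      = fromℚ 1ℚ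
  ; isCommutativeRing = record
    { isRing = record
      { +-isAbelianGroup = record
        { isGroup = record
          { isMonoid = record
            { isSemigroup = record
              { isMagma = record
                { isEquivalence = record
                  { refl  = pointwise λ _ → refl
                  ; sym   = ≈-sym
                  ; trans = ≈-trans
                  }
                ; ∙-cong = +-cong
                }
              ; assoc = λ a b c → pointwise λ n →
                  ℚ.+-assoc (seq a n) (seq b n) (seq c n)
              }
            ; identity = (λ a → pointwise λ n → ℚ.+-identityˡ (seq a n))
                       , (λ a → pointwise λ n → ℚ.+-identityʳ (seq a n))
            }
          ; inverse = (λ a → pointwise λ n → ℚ.+-inverseˡ (seq a n))
                    , (λ a → pointwise λ n → ℚ.+-inverseʳ (seq a n))
          ; ⁻¹-cong = -‿cong
          }
        ; comm = λ a b → pointwise λ n → ℚ.+-comm (seq a n) (seq b n)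
        }
      ; *-cong     = *-cong
      ; *-assoc    = λ a b c → pointwise λ n →
          ℚ.*-assoc (seq a n) (seq b n) (seq c n)
      ; *-identity = (λ a → pointwise λ n → ℚ.*-identityˡ (seq a n))
                   , (λ a → pointwise λ n → ℚ.*-identityʳ (seq a n))
      ; distrib    = (λ a b c → pointwise λ n →
                        ℚ.*-distribˡ-+ (seq a n) (seq b n) (seq c n))
                   , (λ a b c → pointwise λ n →
                        ℚ.*-distribʳ-+ (seq a n) (seq b n) (seq c n))
      }
    ; *-comm = λ a b → pointwise λ n → ℚ.*-comm (seq a n) (seq b n)
    }
  }

------------------------------------------------------------------------
-- Forms and the SOS rank

module ℝR = CommutativeRing ℝ-commutativeRing

open RawMonoidDefinitions ℝR.+-rawMonoid using (sum) public

infix 9 _²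

_² : ℝ → ℝ
a ² = a *ℝ a

-- A form is identified with the polynomial function it induces on
-- ℝᵐ × ℝⁿ, which is harmless because ℝ is infinite.
Form : ℕ → ℕ → Set
Form m n = Vector ℝ m → Vector ℝ n → ℝ

infix 4 _≋_

_≋_ : ∀ {m n} → Form m n → Form m n → Set
P ≋ Q = ∀ x y → P x y ≈ℝ Q x y

bilinear : ∀ {m n} → (Fin m → Fin n → ℝ) → Form m n
bilinear a x y = sum λ i → sum λ j → a i j *ℝ (x i *ℝ y j)

IsSumOfSquares : ∀ {m n} → Form m n → ℕ → Set
IsSumOfSquares {m} {n} P r =
  Σ[ B ∈ (Fin r → Fin m → Fin n → ℝ) ]
    P ≋ (λ x y → sum λ k → (bilinear (B k) x y) ²)

IsSOSRank : ∀ {m n} → Form m n → ℕ → Set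
IsSOSRank P r =
  IsSumOfSquares P r × (∀ s → IsSumOfSquares P s → r ℕ.≤ s)

-- SOS(P) ≤ k.  The minimum is not named, since it cannot be computed
-- constructively from the mere existence of a representation.
SOSRank≤ : ∀ {m n} → Form m n → ℕ → Set
SOSRank≤ P k = ∃[ r ] (r ℕ.≤ k × IsSumOfSquares P r)

------------------------------------------------------------------------
-- Cells, bipartite graphs and the Zarankiewicz number

Cell : ℕ → ℕ → Set
Cell m n = Fin m × Fin n

row : ∀ {m n} → Cell m n → Fin m
row = proj₁

col : ∀ {m n} → Cell m n → Fin n
col = proj₂

monomial : ∀ {m n} → Cell m n → Form m n
monomial (i , j) x y = x i *ℝ y j

sumOver : ∀ {A : Set} → List A → (A → ℝ) → ℝ
sumOver as f = foldr (λ a s → f a +ℝ s) (fromℚ 0ℚ) as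

-- Finite sets are represented by duplicate-free lists.
C₄-Free : ∀ {m n} → List (Cell m n) → Set
C₄-Free E =
  ∀ i k j l → i ≢ k → j ≢ l →
  ¬ ((i , j) ∈ E × (i , l) ∈ E × (k , j) ∈ E × (k , l) ∈ E)

IsZarankiewicz : ℕ → ℕ → ℕ → Set
IsZarankiewicz m n z =
  (Σ[ E ∈ List (Cell m n) ] Unique E × C₄-Free E × length E ≡ z) ×
  (∀ (E : List (Cell m n)) → Unique E → C₄-Free E → length E ℕ.≤ z)

------------------------------------------------------------------------
-- Augmented bipartite graphs

-- The unordered pair (i,j;k,l) is represented by either of its two
-- orderings; equality of unordered pairs is _∼_.
TwoEdge : ℕ → ℕ → Set
TwoEdge m n = Cell m n × Cell m n

infix 4 _∼_ _≁_

_∼_ _≁_ : ∀ {m n} → TwoEdge m n → TwoEdge m n → Set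
e ∼ f = e ≡ f ⊎ e ≡ swap f
e ≁ f = ¬ (e ∼ f)

halves : ∀ {m n} → TwoEdge m n → List (Cell m n)
halves (c , d) = c ∷ d ∷ []

record AugmentedBipartiteGraph (m n : ℕ) : Set where
  field
    E₁          : List (Cell m n)
    E₁-unique   : Unique E₁
    E₂          : List (TwoEdge m n)
    E₂-distinct : All (λ (c , d) → c ≢ d) E₂
    E₂-unique   : AllPairs _≁_ E₂

Nondegenerate : ∀ {m n} → TwoEdge m n → Set
Nondegenerate (c , d) = row c ≢ row d × col c ≢ col d

opposite : ∀ {m n} → TwoEdge m n → Cell m n × Cell m n
opposite ((i , j) , (k , l)) = (i , l) , (k , j)

Complementary : ∀ {m n} → TwoEdge m n → TwoEdge m n → Set
Complementary e f = Nondegenerate e × Nondegenerate f × f ∼ opposite e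

data Edge (m n : ℕ) : Set where
  one : Cell m n → Edge m n
  two : TwoEdge m n → Edge m n

cells : ∀ {m n} → Edge m n → List (Cell m n)
cells (one c) = [ c ]
cells (two e) = halves e

rows : ∀ {m n} → Edge m n → List (Fin m)
rows e = map row (cells e)

cols : ∀ {m n} → Edge m n → List (Fin n)
cols e = map col (cells e)

data IsTwoEdge {m n : ℕ} : Edge m n → Set where
  isTwoEdge : ∀ e → IsTwoEdge (two e)

VertexDisjoint : ∀ {m n} → Edge m n → Edge m n → Set
VertexDisjoint e f = Disjoint (rows e) (rows f) × Disjoint (cols e) (cols f)

oppositeCells : ∀ {m n} → Edge m n → Edge m n → List (Cell m n)
oppositeCells e f =
  cartesianProduct (rows e) (cols f) ++ cartesianProduct (rows f) (cols e)

module _ {m n : ℕ} (G : AugmentedBipartiteGraph m n) where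
  open AugmentedBipartiteGraph G

  ∣E₁∣ ∣E₂∣ : ℕ
  ∣E₁∣ = length E₁
  ∣E₂∣ = length E₂

  Limited : Set
  Limited = IsZarankiewicz m n ∣E₁∣

  Occupied : Cell m n → Set
  Occupied c = c ∈ E₁ ⊎ ∃[ e ] (e ∈ E₂ × c ∈ halves e)

  IsEdge : Edge m n → Set
  IsEdge (one c) = c ∈ E₁
  IsEdge (two e) = e ∈ E₂

  associatedForm : Form m n
  associatedForm x y =
    sumOver E₁ (λ (i , j) → x i ² *ℝ y j ²) +ℝ
    sumOver E₂ (λ (c , d) → (monomial c x y +ℝ monomial d x y) ²)

  Irreducible : Set
  Irreducible = IsSOSRank associatedForm (∣E₁∣ ℕ.+ ∣E₂∣)

  -- Vertices of the dependency graph.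
  IsVertex : TwoEdge m n → Set
  IsVertex e = e ∈ E₂ × Nondegenerate e

  -- Arcs of the dependency graph.
  record Arc (e e′ : TwoEdge m n) : Set where
    field
      source    : IsVertex e
      target    : IsVertex e′
      different : e ≁ e′
      occupied  : All Occupied (halves (opposite e))
      meets     : ∃[ c ] (c ∈ halves (opposite e) × c ∈ halves e′)

  -- v ∷ vs are the vertices of the cycle in order, without repetition.
  IsDirectedCycle : TwoEdge m n → List (TwoEdge m n) → Set
  IsDirectedCycle v vs = AllPairs _≁_ (v ∷ vs) × Linked Arc (v ∷ (vs ∷ʳ v))

  ConditionS : Set
  ConditionS =
    (∀ e c → e ∈ E₂ → c ∈ halves e → c ∉ E₁) ×
    (∀ e f c → e ∈ E₂ → f ∈ E₂ → e ≁ f → c ∈ halves e → c ∉ halves f)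

  ConditionW1 : Set
  ConditionW1 = C₄-Free E₁

  ConditionW2 : Set
  ConditionW2 =
    ∀ v vs → IsDirectedCycle v vs → ∃[ w ] (vs ≡ [ w ] × Complementary v w)

  ConditionW2′ : Set
  ConditionW2′ =
    ¬ (∃[ e ] (e ∈ E₂ × Nondegenerate e × All (_∈ E₁) (halves (opposite e))))

  ConditionW3 : Set
  ConditionW3 =
    ∀ e f → IsEdge e → IsEdge f → IsTwoEdge e ⊎ IsTwoEdge f →
    VertexDisjoint e f → Any (λ c → ¬ Occupied c) (oppositeCells e f)

{-# OPTIONS --safe #-}

-- With row 0 and column 3 special, E₁ = {(0,a), (a+1,3), (a+1,a) : a = 0,1,2}
-- is the extremal C₄-free graph, and E₂ = {(1,1;1,2), (2,0;2,2)}.  Both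
-- 2-edges are row-degenerate, so the dependency graph has no vertices.
--
-- Write m_ij = x_i y_j, e = m₁₁ + m₁₂ and f = m₂₀ + m₂₂.  Since
-- m_ij m_kl = m_il m_kj, the form has many Gram matrices.  Moving along these
-- relations with weights ±½ on the 2×2 rectangles all of whose cells are
-- occupied gives a Gram matrix of rank 9, that is, the form is the sum of the squares of
--   m₀₀ + ½(m₂₁ − e),  m₀₁ + ½(m₁₀ − f),  m₀₂ + ½(m₁₀ + m₂₁),
--   m₁₃ − ½(m₂₁ + f),  m₂₃ + ½(m₁₀ + e),  m₃₂,  m₃₃,
--   ½(e + f),  ½(m₂₁ − m₁₀ + e − f).

module Submission where

open import Defs
open import Data.Bool.Base using (true; false)
open import Data.Fin.Base using (Fin; zero; suc; _↑ˡ_; _↑ʳ_)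
open import Data.Fin.Patterns using (0F; 1F; 2F; 3F)
import Data.Fin.Properties as Fin
open import Data.Fin.Subset as Subset using (Subset; ∣_∣)
import Data.Fin.Subset.Properties as Subset
open import Data.List.Base as List
  using (List; []; _∷_; length; map; filter; concatMap; lookup; allFin)
import Data.List.Membership.DecPropositional as DecMembership
open import Data.List.Membership.Propositional using (_∈_; lose)
open import Data.List.Membership.Propositional.Properties
  using (∈-lookup; ∈-allFin; ∈-map⁺; ∈-filter⁺; ∈-concatMap⁺)
open import Data.List.Membership.Setoid.Properties using (index-injective)
import Data.List.Properties as List
open import Data.List.Relation.Binary.Subset.Propositional using (_⊆_)
open import Data.List.Relation.Unary.All as All using (All; []; _∷_)
open import Data.List.Relation.Unary.AllPairs using (allPairs?; []; _∷_)
open import Data.List.Relation.Unary.Any using (here; there; index)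
open import Data.List.Relation.Unary.Linked using (_∷_)
open import Data.List.Relation.Unary.Unique.Propositional using (Unique)
open import Data.Nat.Base using (ℕ; _+_; _<_; _≤_)
import Data.Nat.ListAction as ListAction
open import Data.Nat.Properties
  using (≤-reflexive; ≤-trans; ≮⇒≥; _<?_; _≤?_)
open import Data.Product.Base using (Σ-syntax; ∃-syntax; _×_; _,_; proj₁; proj₂; swap)
open import Data.Product.Properties using (≡-dec)
open import Data.Rational.Base using (ℚ; 0ℚ; 1ℚ; ½; -_)
open import Data.Rational.Solver using (module +-*-Solver)
open import Data.Sum.Base using (inj₁; inj₂)
open import Data.Vec.Base as Vec using (Vec; []; _∷_)
import Data.Vec.Functional as Vector
open import Data.Vec.Properties using ([]=⇒lookup; lookup∘tabulate)
open import Relation.Binary.Definitions using (DecidableEquality)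
open import Relation.Binary.PropositionalEquality
  using (_≡_; _≢_; refl; sym; trans; cong; subst; setoid)
open import Relation.Nullary using (¬_; Dec; does; proof; invert; contradiction)
open import Relation.Nullary.Decidable
  using (¬?; _×-dec_; _⊎-dec_; _→-dec_; from-yes; from-no)
open import Relation.Nullary.Reflects using (Reflects)
open import Relation.Unary using (Decidable)

-- Counting with duplicate-free lists and finite subsets.

module _ {A : Set} where

  unique⇒lookup-injective : ∀ {xs : List A} → Unique xs →
    ∀ {i j} → lookup xs i ≡ lookup xs j → i ≡ j
  unique⇒lookup-injective (_  ∷ _) {zero}  {zero}  _  = refl
  unique⇒lookup-injective (x∉ ∷ _) {zero}  {suc j} eq =
    contradiction eq (All.lookup x∉ (∈-lookup j))
  unique⇒lookup-injective (x∉ ∷ _) {suc i} {zero}  eq =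
    contradiction (sym eq) (All.lookup x∉ (∈-lookup i))
  unique⇒lookup-injective (_  ∷ u) {suc i} {suc j} eq =
    cong suc (unique⇒lookup-injective u eq)

  -- Pigeonhole: sending a position in `xs` to the position where its entry is found in `ys` is
  -- injective.
  unique-⊆⇒length≤ : ∀ {xs ys : List A} → Unique xs → xs ⊆ ys →
    length xs ≤ length ys
  unique-⊆⇒length≤ u xs⊆ys =
    Fin.injective⇒≤ {f = λ i → index (xs⊆ys (∈-lookup i))} λ eq →
      unique⇒lookup-injective u (index-injective (setoid A) _ _ eq)

subset : ∀ {n} {P : Fin n → Set} → Decidable P → Subset n
subset P? = Vec.tabulate λ i → does (P? i)

∈-subset⁻ : ∀ {n} {P : Fin n → Set} (P? : Decidable P) {i} →
  i Subset.∈ subset P? → P i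
∈-subset⁻ P? {i} i∈ = invert (subst (Reflects _)
  (trans (sym (lookup∘tabulate _ i)) ([]=⇒lookup i∈)) (proof (P? i)))

-- The function `f` is arbitrary because the induction shifts it along `suc`; `allFin` is the case
-- of the identity.
length-filter-tabulate : ∀ {n} {A : Set} {P : A → Set} (P? : Decidable P)
  (f : Fin n → A) →
  length (filter P? (List.tabulate f)) ≡ ∣ subset (λ i → P? (f i)) ∣
length-filter-tabulate {ℕ.zero}  P? f = refl
length-filter-tabulate {ℕ.suc n} P? f with does (P? (f zero))
... | true  = cong ℕ.suc (length-filter-tabulate P? λ i → f (suc i))
... | false = length-filter-tabulate P? λ i → f (suc i)

length-concatMap : ∀ {A B : Set} (f : A → List B) xs →
  length (concatMap f xs) ≡ ListAction.sum (map (λ x → length (f x)) xs)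
length-concatMap f []       = refl
length-concatMap f (x ∷ xs) =
  trans (List.length-++ (f x)) (cong (length (f x) +_) (length-concatMap f xs))

-- Decision procedures for cells, 2-edges and C₄-freeness.

infix 4 _≟ᶜ_ _≟ᵉ_

_≟ᶜ_ : ∀ {m n} → DecidableEquality (Cell m n)
_≟ᶜ_ = ≡-dec Fin._≟_ Fin._≟_

_≟ᵉ_ : ∀ {m n} → DecidableEquality (TwoEdge m n)
_≟ᵉ_ = ≡-dec _≟ᶜ_ _≟ᶜ_

_∼?_ : ∀ {m n} (e f : TwoEdge m n) → Dec (e ∼ f)
e ∼? f = (e ≟ᵉ f) ⊎-dec (e ≟ᵉ swap f)

open module CellMembership {m n} = DecMembership (_≟ᶜ_ {m} {n}) using (_∈?_; _∉?_)

C₄-free? : ∀ {m n} (E : List (Cell m n)) → Dec (C₄-Free E)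
C₄-free? E =
  Fin.all? λ i → Fin.all? λ k → Fin.all? λ j → Fin.all? λ l →
  ¬? (i Fin.≟ k) →-dec ¬? (j Fin.≟ l) →-dec
  ¬? ((i , j) ∈? E ×-dec (i , l) ∈? E ×-dec (k , j) ∈? E ×-dec (k , l) ∈? E)

-- The upper bound z(4,4) ≤ 9.

module _ {m n : ℕ} (E : List (Cell m n)) where

  neighbours : Fin m → Subset n
  neighbours i = subset λ j → (i , j) ∈? E

  -- Listing the edges row by row gives a list that contains `E` and whose length is the degree sum.
  length≤∑∣neighbours∣ : Unique E →
    length E ≤ ListAction.sum (map (λ i → ∣ neighbours i ∣) (allFin m))
  length≤∑∣neighbours∣ unique =
    ≤-trans (unique-⊆⇒length≤ unique E⊆)
      (≤-reflexive (trans (length-concatMap edgesAt (allFin m))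
        (cong ListAction.sum (List.map-cong length-edgesAt (allFin m)))))
    where
    columns : Fin m → List (Fin n)
    columns i = filter (λ j → (i , j) ∈? E) (allFin n)

    edgesAt : Fin m → List (Cell m n)
    edgesAt i = map (i ,_) (columns i)

    length-edgesAt : ∀ i → length (edgesAt i) ≡ ∣ neighbours i ∣
    length-edgesAt i = trans (List.length-map (i ,_) (columns i))
      (length-filter-tabulate (λ j → (i , j) ∈? E) (λ j → j))

    E⊆ : E ⊆ concatMap edgesAt (allFin m)
    E⊆ {i , j} ij∈E = ∈-concatMap⁺ edgesAt
      (lose (∈-allFin i) (∈-map⁺ (i ,_)
        (∈-filter⁺ (λ j → (i , j) ∈? E) (∈-allFin j) ij∈E)))

-- This is C₄-freeness seen from two rows: two common neighbours would close a C₄.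
Compatible : ∀ {n} → Subset n → Subset n → Set
Compatible p q = ∀ j l → j ≢ l →
  ¬ (j Subset.∈ p × l Subset.∈ p × j Subset.∈ q × l Subset.∈ q)

compatible? : ∀ {n} (p q : Subset n) → Dec (Compatible p q)
compatible? p q = Fin.all? λ j → Fin.all? λ l → ¬? (j Fin.≟ l) →-dec
  ¬? (j Subset.∈? p ×-dec l Subset.∈? p ×-dec j Subset.∈? q ×-dec l Subset.∈? q)

neighbours-compatible : ∀ {m n} (E : List (Cell m n)) → C₄-Free E →
  ∀ {i k} → i ≢ k → Compatible (neighbours E i) (neighbours E k)
neighbours-compatible E free {i} {k} i≢k j l j≢l (ij , il , kj , kl) =
  free i k j l i≢k j≢l
    (∈-subset⁻ (λ j → (i , j) ∈? E) ij , ∈-subset⁻ (λ j → (i , j) ∈? E) il ,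
     ∈-subset⁻ (λ j → (k , j) ∈? E) kj , ∈-subset⁻ (λ j → (k , j) ∈? E) kl)

-- p, q, r, s stand for the neighbourhoods of the four rows.  The conditions are
-- interleaved with the quantifiers to prune the search.
¬tenEdges : ¬ (∃[ p ] ∃[ q ] (Compatible {4} p q ×
  ∃[ r ] (Compatible p r × Compatible q r ×
  ∃[ s ] (9 < ListAction.sum (∣ p ∣ ∷ ∣ q ∣ ∷ ∣ r ∣ ∷ ∣ s ∣ ∷ []) ×
    Compatible p s × Compatible q s × Compatible r s))))
¬tenEdges = from-no (Subset.anySubset? {4} λ p → Subset.anySubset? λ q →
  compatible? p q ×-dec Subset.anySubset? λ r →
  compatible? p r ×-dec compatible? q r ×-dec Subset.anySubset? λ s →
  (9 <? ListAction.sum (∣ p ∣ ∷ ∣ q ∣ ∷ ∣ r ∣ ∷ ∣ s ∣ ∷ [])) ×-dec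
  compatible? p s ×-dec compatible? q s ×-dec compatible? r s)

-- Passing to the four neighbourhoods replaces arbitrary edge lists by quadruples of subsets of four
-- columns, which `¬tenEdges` searches exhaustively.
C₄-free⇒length≤9 : (E : List (Cell 4 4)) → Unique E → C₄-Free E → length E ≤ 9
C₄-free⇒length≤9 E unique free =
  ≤-trans (length≤∑∣neighbours∣ E unique) (≮⇒≥ λ 9< →
    ¬tenEdges (N 0F , N 1F , compatible (λ ()) , N 2F , compatible (λ ()) ,
      compatible (λ ()) , N 3F , 9< ,
      compatible (λ ()) , compatible (λ ()) , compatible (λ ())))
  where
  N = neighbours E

  compatible : ∀ {i k} → i ≢ k → Compatible (N i) (N k)
  compatible = neighbours-compatible E free

-- The graph and its combinatorial conditions.

oneEdges : List (Cell 4 4)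
oneEdges =
  (0F , 0F) ∷ (0F , 1F) ∷ (0F , 2F) ∷
  (1F , 0F) ∷ (2F , 1F) ∷ (3F , 2F) ∷
  (1F , 3F) ∷ (2F , 3F) ∷ (3F , 3F) ∷ []

twoEdges : List (TwoEdge 4 4)
twoEdges = ((1F , 1F) , (1F , 2F)) ∷ ((2F , 0F) , (2F , 2F)) ∷ []

G : AugmentedBipartiteGraph 4 4
G = record
  { E₁          = oneEdges
  ; E₁-unique   = from-yes (allPairs? (λ c d → ¬? (c ≟ᶜ d)) oneEdges)
  ; E₂          = twoEdges
  ; E₂-distinct = from-yes (All.all? (λ (c , d) → ¬? (c ≟ᶜ d)) twoEdges)
  ; E₂-unique   = from-yes (allPairs? (λ e f → ¬? (e ∼? f)) twoEdges)
  }

G-W1 : ConditionW1 G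
G-W1 = from-yes (C₄-free? oneEdges)

G-limited : Limited G
G-limited = (oneEdges , G.E₁-unique , G-W1 , refl) , C₄-free⇒length≤9
  where module G = AugmentedBipartiteGraph G

G-S : ConditionS G
G-S =
  (λ e c e∈ c∈ → All.lookup (All.lookup avoidsE₁ e∈) c∈) ,
  (λ e f c e∈ f∈ e≁f c∈ →
    All.lookup (All.lookup (All.lookup avoidsE₂ e∈) f∈ e≁f) c∈)
  where
  avoidsE₁ = from-yes (All.all? (λ e → All.all? (_∉? oneEdges) (halves e)) twoEdges)
  avoidsE₂ = from-yes (All.all? (λ e → All.all? (λ f →
    ¬? (e ∼? f) →-dec All.all? (_∉? halves f) (halves e)) twoEdges) twoEdges)

G-degenerate : ∀ {e} → e ∈ twoEdges → ¬ Nondegenerate e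
G-degenerate (here refl)         (rows≢ , _) = rows≢ refl
G-degenerate (there (here refl)) (rows≢ , _) = rows≢ refl

G-noArc : ∀ {e f} → ¬ Arc G e f
G-noArc arc = G-degenerate (proj₁ (Arc.source arc)) (proj₂ (Arc.source arc))

G-W2 : ConditionW2 G
-- The closing `∷ʳ v` gives even a one-vertex cycle an arc, so every cycle starts with one.
G-W2 v []       (_ , arc ∷ _) = contradiction arc G-noArc
G-W2 v (_ ∷ _) (_ , arc ∷ _) = contradiction arc G-noArc

G-W2′ : ConditionW2′ G
G-W2′ (e , e∈ , nondegenerate , _) = G-degenerate e∈ nondegenerate

G-¬W3 : ¬ ConditionW3 G
G-¬W3 W3 = let c-occupied , c-unoccupied = All.lookupAny occupied unoccupied in
  c-unoccupied c-occupied
  where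
  -- The opposite cells of this pair are `(0F , 1F)`, `(0F , 2F)` and `(1F , 0F)`, all of them
  -- 1-edges.
  e = one (0F , 0F)
  f = two ((1F , 1F) , (1F , 2F))

  unoccupied = W3 e f (here refl) (here refl) (inj₂ (isTwoEdge _))
    ((λ { (here refl , there (there ())) }) ,
     (λ { (here refl , there (there ())) }))

  occupied : All (Occupied G) (oppositeCells e f)
  occupied = All.map inj₁ (from-yes (All.all? (_∈? oneEdges) (oppositeCells e f)))

-- The nine squares and reducibility.

coefficients : Vec (Vec (Vec ℚ 4) 4) 9
coefficients =
  -- One matrix for each of the nine forms listed at the start, in that order; entry (i, j) is the
  -- coefficient of m_ij.
  ((1ℚ ∷ 0ℚ ∷ 0ℚ ∷ 0ℚ ∷ []) ∷ (0ℚ ∷ -½ ∷ -½ ∷ 0ℚ ∷ []) ∷ (0ℚ ∷ ½ ∷ 0ℚ ∷ 0ℚ ∷ []) ∷ 0⃗ ∷ []) ∷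
  ((0ℚ ∷ 1ℚ ∷ 0ℚ ∷ 0ℚ ∷ []) ∷ (½ ∷ 0ℚ ∷ 0ℚ ∷ 0ℚ ∷ []) ∷ (-½ ∷ 0ℚ ∷ -½ ∷ 0ℚ ∷ []) ∷ 0⃗ ∷ []) ∷
  ((0ℚ ∷ 0ℚ ∷ 1ℚ ∷ 0ℚ ∷ []) ∷ (½ ∷ 0ℚ ∷ 0ℚ ∷ 0ℚ ∷ []) ∷ (0ℚ ∷ ½ ∷ 0ℚ ∷ 0ℚ ∷ []) ∷ 0⃗ ∷ []) ∷
  (0⃗ ∷ (0ℚ ∷ 0ℚ ∷ 0ℚ ∷ 1ℚ ∷ []) ∷ (-½ ∷ -½ ∷ -½ ∷ 0ℚ ∷ []) ∷ 0⃗ ∷ []) ∷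
  (0⃗ ∷ (½ ∷ ½ ∷ ½ ∷ 0ℚ ∷ []) ∷ (0ℚ ∷ 0ℚ ∷ 0ℚ ∷ 1ℚ ∷ []) ∷ 0⃗ ∷ []) ∷
  (0⃗ ∷ 0⃗ ∷ 0⃗ ∷ (0ℚ ∷ 0ℚ ∷ 1ℚ ∷ 0ℚ ∷ []) ∷ []) ∷
  (0⃗ ∷ 0⃗ ∷ 0⃗ ∷ (0ℚ ∷ 0ℚ ∷ 0ℚ ∷ 1ℚ ∷ []) ∷ []) ∷
  (0⃗ ∷ (0ℚ ∷ ½ ∷ ½ ∷ 0ℚ ∷ []) ∷ (½ ∷ 0ℚ ∷ ½ ∷ 0ℚ ∷ []) ∷ 0⃗ ∷ []) ∷
  (0⃗ ∷ (-½ ∷ ½ ∷ ½ ∷ 0ℚ ∷ []) ∷ (-½ ∷ ½ ∷ -½ ∷ 0ℚ ∷ []) ∷ 0⃗ ∷ []) ∷ []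
  where
  -½ : ℚ
  -½ = - ½
  0⃗ : Vec ℚ 4
  0⃗ = Vec.replicate 4 0ℚ

coefficient : Fin 9 → Fin 4 → Fin 4 → ℚ
coefficient k i j = Vec.lookup (Vec.lookup (Vec.lookup coefficients k) i) j

-- The two polynomials mirror the shapes of associatedForm G and of the sum of
-- squares, so that evaluating them at the n-th terms of the sequences of x and
-- y gives the n-th terms of both sides definitionally.
G-sumOf9Squares : IsSumOfSquares (associatedForm G) 9
G-sumOf9Squares = (λ k i j → fromℚ (coefficient k i j)) , λ x y →
  ≈ℝ-Lemmas.pointwise λ n →
    prove
      (seq (x 0F) n ∷ seq (x 1F) n ∷ seq (x 2F) n ∷ seq (x 3F) n ∷
       seq (y 0F) n ∷ seq (y 1F) n ∷ seq (y 2F) n ∷ seq (y 3F) n ∷ [])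
      formᴾ squaresᴾ refl
  where
  open +-*-Solver

  xᴾ yᴾ : Fin 4 → Polynomial 8
  xᴾ i = var (i ↑ˡ 4)
  yᴾ j = var (4 ↑ʳ j)

  square : Polynomial 8 → Polynomial 8
  square p = p :* p

  monomialᴾ : Cell 4 4 → Polynomial 8
  monomialᴾ (i , j) = xᴾ i :* yᴾ j

  sumOverᴾ : ∀ {A : Set} → List A → (A → Polynomial 8) → Polynomial 8
  sumOverᴾ as f = List.foldr (λ a s → f a :+ s) (con 0ℚ) as

  sumᴾ : ∀ {n} → (Fin n → Polynomial 8) → Polynomial 8
  sumᴾ = Vector.foldr _:+_ (con 0ℚ)

  formᴾ squaresᴾ : Polynomial 8
  formᴾ =
    sumOverᴾ oneEdges (λ (i , j) → square (xᴾ i) :* square (yᴾ j)) :+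
    sumOverᴾ twoEdges (λ (c , d) → square (monomialᴾ c :+ monomialᴾ d))
  squaresᴾ = sumᴾ λ k → square
    (sumᴾ λ i → sumᴾ λ j → con (coefficient k i j) :* monomialᴾ (i , j))

-- Irreducibility would make 11 the least number of squares, yet nine suffice.
G-reducible : ¬ Irreducible G
G-reducible (_ , minimal) = from-no (11 ≤? 9) (minimal 9 G-sumOf9Squares)

proposition22 : (Σ[ G ∈ AugmentedBipartiteGraph 4 4 ]
    Limited G × ConditionS G × ConditionW1 G × ConditionW2 G × ConditionW2′ G ×
    ¬ ConditionW3 G ×
    SOSRank≤ (associatedForm G) 10 ×
    10 < 11 ×
    11 ≡ ∣E₁∣ G + ∣E₂∣ G ×
    ¬ Irreducible G) ×
    ¬ (∀ (m n : ℕ) (G : AugmentedBipartiteGraph m n) →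
    ConditionS G → ConditionW1 G → ConditionW2 G → ConditionW2′ G →
    Irreducible G)
proposition22 =
  (G , G-limited , G-S , G-W1 , G-W2 , G-W2′ , G-¬W3 ,
   -- The representation found is one square shorter than the bound 10 requires.
   (9 , from-yes (9 ≤? 10) , G-sumOf9Squares) ,
   from-yes (10 <? 11) , refl , G-reducible) ,
  λ irreducible → G-reducible (irreducible 4 4 G G-S G-W1 G-W2 G-W2′)
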